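{- For every positive even integer $k$, every connected, false twin-free and total $k$-uniform graph is regular.
   Context: All graphs are finite and simple. $N(v)$ is the set of neighbors of $v$. Two distinct vertices $u,v$ are false twins if $N(u)=N(v)$; a graph is false twin-free if it has no false twins. For a graph $G$ with no isolated vertices, a total dominating set is a set $A\subseteq V(G)$ such that every vertex of $G$ has a neighbor in $A$; $\gamma_t(G)$ is the minimum size of one. A sequence $(v_1,\dots,v_m)$ of distinct vertices is legal if $N(v_i)\setminus\bigcup_{j=1}^{i-1}N(v_j)\neq\emptyset$ for every $i\in\{2,\dots,m\}$; it is a total dominating sequence if moreover $\{v_1,\dots,v_m\}$ is a total dominating set. $\gamma_{gr}^t(G)$ is the maximum length of a total dominating sequence. $G$ is total $k$-uniform if $\gamma_t(G)=\gamma_{gr}^t(G)=k$. -}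

module Defs where

open import Data.Nat using (ℕ; zero; suc; _≤_)
open import Data.Bool using (Bool; true; false)
open import Data.Fin using (Fin)
open import Data.Fin.Subset using (Subset; _∈_; ∣_∣)
open import Data.Vec using (tabulate)
open import Data.List using (List; []; _∷_; _++_; [_]; length)
open import Data.List.Relation.Unary.All using (All)
open import Data.List.Relation.Unary.Unique.Propositional using (Unique)
open import Data.List.Membership.Propositional renaming (_∈_ to _∈ₗ_)
open import Data.Product using (Σ; ∃; _×_; _,_)
open import Data.Unit using (⊤)
open import Data.Empty using (⊥)
open import Relation.Binary.PropositionalEquality using (_≡_; _≢_)

record Graph (n : ℕ) : Set where
  field
    adj   : Fin n → Fin n → Bool
    sym   : ∀ u v → adj u v ≡ adj v u
    irref : ∀ v → adj v v ≡ false
open Graph public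

module _ {n : ℕ} (G : Graph n) where

  N : Fin n → Subset n
  N v = tabulate (adj G v)

  degree : Fin n → ℕ
  degree v = ∣ N v ∣

  Regular : Set
  Regular = ∃ λ d → ∀ v → degree v ≡ d

  data Walk : Fin n → Fin n → Set where
    here : ∀ {v} → Walk v v
    step : ∀ {u v w} → adj G u v ≡ true → Walk v w → Walk u w

  Connected : Set
  Connected = ∀ u v → Walk u v

  FalseTwins : Fin n → Fin n → Set
  FalseTwins u v = u ≢ v × N u ≡ N v

  FalseTwinFree : Set
  FalseTwinFree = ∀ u v → FalseTwins u v → ⊥

  TotalDominatingSet : Subset n → Set
  TotalDominatingSet A = ∀ v → ∃ λ u → u ∈ A × u ∈ N v

  TotalDomNumberIs : ℕ → Set
  TotalDomNumberIs k =
    (Σ (Subset n) λ A → TotalDominatingSet A × ∣ A ∣ ≡ k) ×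
    (∀ A → TotalDominatingSet A → k ≤ ∣ A ∣)

  -- Legality: each v_i (i ≥ 2) has a neighbour w not adjacent to any earlier v_j,
  -- i.e. N(v_i) \ ⋃_{j<i} N(v_j) ≠ ∅.  First argument = prefix already chosen.
  LegalFrom : List (Fin n) → List (Fin n) → Set
  LegalFrom pre [] = ⊤
  LegalFrom [] (v ∷ rest) = LegalFrom [ v ] rest
  LegalFrom pre@(_ ∷ _) (v ∷ rest) =
    (∃ λ w → w ∈ N v × All (λ u → adj G u w ≡ false) pre) × LegalFrom (pre ++ [ v ]) rest

  LegalSequence : List (Fin n) → Set
  LegalSequence vs = Unique vs × LegalFrom [] vs

  TotalDominatingSequence : List (Fin n) → Set
  TotalDominatingSequence vs =
    LegalSequence vs × (∀ v → ∃ λ u → u ∈ₗ vs × u ∈ N v)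

  TotalGrundyNumberIs : ℕ → Set
  TotalGrundyNumberIs k =
    (Σ (List (Fin n)) λ vs → TotalDominatingSequence vs × length vs ≡ k) ×
    (∀ vs → TotalDominatingSequence vs → length vs ≤ k)

  TotalUniform : ℕ → Set
  TotalUniform k = TotalDomNumberIs k × TotalGrundyNumberIs k

{-# OPTIONS --safe #-}
module Submission where

-- Uniformity makes the vertices the points of a modular geometric lattice, the closed sets being
-- the common non-neighbourhoods, and adjacency the non-incidence relation of points and
-- hyperplanes.  An edge u v determines an irreducible geometry whose points are the vertices
-- sharing a neighbour with u and whose hyperplanes are those sharing a neighbour with v.
-- Perspectivities show that all points lie on equally many hyperplanes, and dually.  By induction
-- on the geometry formed by the points on v and the hyperplanes through u, these two numbers
-- agree; double counting incidences then gives as many points as hyperplanes, so u and v have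
-- the same degree.

open import Defs
open import Data.Bool using (Bool; true; false; _∧_; not; if_then_else_)
open import Data.Bool.Properties using (¬-not; ∧-conicalˡ; ∧-conicalʳ; ∧-zeroʳ) renaming (_≟_ to _≟ᵇ_)
open import Data.Empty using (⊥; ⊥-elim)
open import Data.Fin using (Fin; zero; suc)
open import Data.Fin.Properties using (any?; _≟_; suc-injective)
open import Data.Fin.Subset using (Subset; _∈_; _∪_; ⁅_⁆; ∣_∣) renaming (⊥ to ∅)
open import Data.Fin.Subset.Properties using (x∈⁅x⁆; x∈p∪q⁺; ∣⊥∣≡0; ∪-identityˡ; ∣p∣≤∣x∷p∣)
open import Data.List using (List; []; _∷_; _++_; [_]; length; reverse; allFin)
open import Data.List.Membership.Propositional using (find) renaming (_∈_ to _∈ₗ_)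
open import Data.List.Membership.Propositional.Properties using (∈-allFin)
open import Data.List.Properties using (length-++; length-reverse; unfold-reverse; ++-assoc; ++-identityʳ)
open import Data.List.Relation.Binary.Permutation.Propositional.Properties using (↭-reverse; All-resp-↭)
open import Data.List.Relation.Binary.Permutation.Propositional using (↭-sym)
open import Data.List.Relation.Unary.All as All using (All; []; _∷_)
open import Data.List.Relation.Unary.AllPairs.Properties as AllPairs using ()
open import Data.List.Relation.Unary.AllPairs using ([]; _∷_)
open import Data.List.Relation.Unary.Any using (Any; here; there)
open import Data.List.Relation.Unary.Any.Properties using (++⁺ˡ; ++⁺ʳ; ++⁻; reverse⁺)
open import Data.List.Relation.Unary.Unique.Propositional using (Unique)
open import Data.Nat using (ℕ; zero; suc; _+_; _*_; _≤_; _<_; z≤n; s≤s)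
open import Data.Nat.Properties hiding (_≟_; suc-injective)
open import Data.Product using (∃; _×_; _,_; proj₁; proj₂)
open import Data.Sum using (_⊎_; inj₁; inj₂)
open import Data.Unit using (tt)
open import Data.Vec using (tabulate; _∷_)
open import Data.Vec.Properties using (lookup∘tabulate; tabulate-cong; lookup⇒[]=; []=⇒lookup)
open import Function using (flip; _∘_)
open import Relation.Binary.PropositionalEquality using (_≡_; _≢_; refl; trans; cong; subst; module ≡-Reasoning) renaming (sym to ≡-sym)
open import Relation.Nullary using (¬_; Dec; yes; no; does)
open import Relation.Nullary.Decidable using (_×-dec_; dec-true)
open import Algebra.Properties.Semiring.Sum +-*-semiring using (sum; sum-cong-≗; ∑-distrib-+; ∑-comm; *-distribˡ-sum; *-distribʳ-sum)

-- Booleans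

true≢false : ∀ {b} → b ≡ true → b ≢ false
true≢false refl ()

∧-intro : ∀ {a b} → a ≡ true → b ≡ true → a ∧ b ≡ true
∧-intro refl refl = refl

not-true : ∀ {b} → not b ≡ true → b ≡ false
not-true {false} _ = refl

does⇒ : ∀ {A : Set} (d : Dec A) → does d ≡ true → A
does⇒ (yes a) _ = a

-- Counting

⟦_⟧ : Bool → ℕ
⟦ b ⟧ = if b then 1 else 0

count : ∀ {n} → (Fin n → Bool) → ℕ
count P = sum (λ i → ⟦ P i ⟧)

count-cong : ∀ {n} {P Q : Fin n → Bool} → (∀ i → P i ≡ Q i) → count P ≡ count Q
count-cong P≗Q = sum-cong-≗ (λ i → cong ⟦_⟧ (P≗Q i))

∣tabulate∣≡count : ∀ {n} (P : Fin n → Bool) → ∣ tabulate P ∣ ≡ count P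
∣tabulate∣≡count {zero} P = refl
∣tabulate∣≡count {suc n} P with P zero
... | true  = cong suc (∣tabulate∣≡count (P ∘ suc))
... | false = ∣tabulate∣≡count (P ∘ suc)

count-split : ∀ {n} (P B : Fin n → Bool) →
  count P ≡ count (λ i → P i ∧ not (B i)) + count (λ i → P i ∧ B i)
count-split P B =
  trans (sum-cong-≗ (λ i → split (P i) (B i)))
        (∑-distrib-+ (λ i → ⟦ P i ∧ not (B i) ⟧) (λ i → ⟦ P i ∧ B i ⟧))
  where
  split : ∀ p b → ⟦ p ⟧ ≡ ⟦ p ∧ not b ⟧ + ⟦ p ∧ b ⟧
  split true true = refl
  split true false = refl
  split false b = refl

count-pos : ∀ {n} (P : Fin n → Bool) i → P i ≡ true → 0 < count P
count-pos P zero    Pi rewrite Pi = s≤s z≤n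
count-pos P (suc i) Pi = ≤-trans (count-pos (P ∘ suc) i Pi) (m≤n+m _ ⟦ P zero ⟧)

count-empty : ∀ {n} (P : Fin n → Bool) → (∀ i → P i ≢ true) → count P ≡ 0
count-empty {zero}  P ¬P = refl
count-empty {suc n} P ¬P rewrite ¬-not (¬P zero) = count-empty (P ∘ suc) (¬P ∘ suc)

count-injection : ∀ {n m} (P : Fin n → Bool) (Q : Fin m → Bool)
  (f : ∀ i → P i ≡ true → Fin m) →
  (∀ i p → Q (f i p) ≡ true) →
  (∀ i j p q → f i p ≡ f j q → i ≡ j) →
  count P ≤ count Q
count-injection {zero} P Q f f∈ f-inj = z≤n
count-injection {suc n} {m} P Q f f∈ f-inj with P zero in P0
... | false = count-injection (P ∘ suc) Q (λ i → f (suc i)) (λ i → f∈ (suc i))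
                (λ i j p q e → suc-injective (f-inj (suc i) (suc j) p q e))
-- The image `j` of the first index is set aside; by injectivity the remaining images avoid it.
... | true = begin
  1 + count (P ∘ suc)  ≤⟨ +-mono-≤ (count-pos _ j (∧-intro (f∈ zero P0) (dec-true (j ≟ j) refl))) rest ⟩
  count (λ i → Q i ∧ does (i ≟ j)) + count (λ i → Q i ∧ not (does (i ≟ j)))
    ≡⟨ +-comm (count (λ i → Q i ∧ does (i ≟ j))) _ ⟩
  count (λ i → Q i ∧ not (does (i ≟ j))) + count (λ i → Q i ∧ does (i ≟ j))
    ≡⟨ count-split Q (λ i → does (i ≟ j)) ⟨
  count Q ∎
  where
  open ≤-Reasoning
  j : Fin m
  j = f zero P0
  avoids : ∀ i p → not (does (f (suc i) p ≟ j)) ≡ true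
  avoids i p with f (suc i) p ≟ j
  ... | no _ = refl
  ... | yes e with () ← f-inj (suc i) zero p P0 e
  rest : count (P ∘ suc) ≤ count (λ i → Q i ∧ not (does (i ≟ j)))
  rest = count-injection (P ∘ suc) (λ i → Q i ∧ not (does (i ≟ j))) (λ i → f (suc i))
    (λ i p → ∧-intro (f∈ (suc i) p) (avoids i p))
    (λ i j p q e → suc-injective (f-inj (suc i) (suc j) p q e))

-- Both sides count the pairs of `P` and `Q` related by `r`, once by rows and once by columns.
double-count : ∀ {n m} (P : Fin n → Bool) (Q : Fin m → Bool) (r : Fin n → Fin m → Bool) c →
  (∀ x → P x ≡ true → count (λ y → Q y ∧ r x y) ≡ c) →
  (∀ y → Q y ≡ true → count (λ x → P x ∧ r x y) ≡ c) →
  count P * c ≡ count Q * c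
double-count P Q r c rows cols = begin
  count P * c                                             ≡⟨ weigh P (λ x y → Q y ∧ r x y) rows ⟩
  sum (λ x → sum (λ y → ⟦ P x ⟧ * ⟦ Q y ∧ r x y ⟧))       ≡⟨ ∑-comm (λ x y → ⟦ P x ⟧ * ⟦ Q y ∧ r x y ⟧) ⟩
  sum (λ y → sum (λ x → ⟦ P x ⟧ * ⟦ Q y ∧ r x y ⟧))
    ≡⟨ sum-cong-≗ (λ y → sum-cong-≗ (λ x → exchange (P x) (Q y) (r x y))) ⟩
  sum (λ y → sum (λ x → ⟦ Q y ⟧ * ⟦ P x ∧ r x y ⟧))       ≡⟨ weigh Q (λ y x → P x ∧ r x y) cols ⟨
  count Q * c                                             ∎
  where
  open ≡-Reasoning
  exchange : ∀ p q b → ⟦ p ⟧ * ⟦ q ∧ b ⟧ ≡ ⟦ q ⟧ * ⟦ p ∧ b ⟧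
  exchange true  true  b = refl
  exchange true  false b = refl
  exchange false true  b = refl
  exchange false false b = refl

  weigh : ∀ {n m} (P : Fin n → Bool) (s : Fin n → Fin m → Bool) →
    (∀ x → P x ≡ true → count (s x) ≡ c) →
    count P * c ≡ sum (λ x → sum (λ y → ⟦ P x ⟧ * ⟦ s x y ⟧))
  weigh P s rows = trans (*-distribʳ-sum c (λ x → ⟦ P x ⟧))
    (sum-cong-≗ (λ x → trans (term x) (*-distribˡ-sum ⟦ P x ⟧ (λ y → ⟦ s x y ⟧))))
    where
    term : ∀ x → ⟦ P x ⟧ * c ≡ ⟦ P x ⟧ * count (s x)
    term x with P x in Px
    ... | true  = cong (_+ 0) (≡-sym (rows x Px))
    ... | false = refl

-- Points P and hyperplanes Q of a projective geometry

-- `R x y ≡ false` is the incidence "x lies on y"; in a graph R is adjacency.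
-- `Span R P h y z` says that z belongs to the pencil of hyperplanes through h ∩ y.
Span : ∀ {n m} → (Fin n → Fin m → Bool) → (Fin n → Bool) → Fin m → Fin m → Fin m → Set
Span R P h y z = ∀ x → P x ≡ true → R x h ≡ false → R x y ≡ false → R x z ≡ false

-- Hyperplanes are the points of the dual geometry and pencils are its lines. `through` is
-- modularity: every dual line meets every dual hyperplane. `meet` is exchange: two distinct members
-- generate the pencil.
record Pencils {n m : ℕ} (R : Fin n → Fin m → Bool) (P : Fin n → Bool) (Q : Fin m → Bool) : Set where
  field
    through : ∀ {x h y} → P x ≡ true → Q h ≡ true → Q y ≡ true → h ≢ y →
      ∃ λ z → Q z ≡ true × Span R P h y z × R x z ≡ false
    meet : ∀ {h y z₁ z₂} → Q h ≡ true → Q y ≡ true → Q z₁ ≡ true → Q z₂ ≡ true → z₁ ≢ z₂ →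
      Span R P h y z₁ → Span R P h y z₂ → Span R P z₁ z₂ h
    antichain : ∀ {z w} → Q z ≡ true → Q w ≡ true → Span R P z z w → z ≡ w

-- `common` and `cocommon` make the geometry irreducible.
record Geometry {n m : ℕ} (R : Fin n → Fin m → Bool) (P : Fin n → Bool) (Q : Fin m → Bool) : Set where
  field
    pencils   : Pencils R P Q
    copencils : Pencils (flip R) Q P
    common    : ∀ {y₁ y₂} → Q y₁ ≡ true → Q y₂ ≡ true →
      ∃ λ x → P x ≡ true × R x y₁ ≡ true × R x y₂ ≡ true
    cocommon  : ∀ {x₁ x₂} → P x₁ ≡ true → P x₂ ≡ true →
      ∃ λ y → Q y ≡ true × R x₁ y ≡ true × R x₂ y ≡ true

dual : ∀ {n m} {R : Fin n → Fin m → Bool} {P Q} → Geometry R P Q → Geometry (flip R) Q P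
dual g = record { pencils = copencils ; copencils = pencils ; common = cocommon ; cocommon = common }
  where open Geometry g

distinct : ∀ {n m} (R : Fin n → Fin m → Bool) {x y z} → R x y ≡ true → R x z ≡ false → y ≢ z
distinct _ xy xz refl = true≢false xy xz

module _ {n m : ℕ} (R : Fin n → Fin m → Bool) {P : Fin n → Bool} where

  span-swap : ∀ {h y z} → Span R P h y z → Span R P y h z
  span-swap s x Px xy xh = s x Px xh xy

  span-right : ∀ {h y} → Span R P h y y
  span-right _ _ _ xy = xy

  not-span : ∀ {h y z} → ¬ Span R P h y z →
    ∃ λ x → P x ≡ true × R x h ≡ false × R x y ≡ false × R x z ≡ true
  not-span {h} {y} {z} ¬s
    with any? (λ x → P x ≟ᵇ true ×-dec R x h ≟ᵇ false ×-dec R x y ≟ᵇ false ×-dec R x z ≟ᵇ true)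
  ... | yes w = w
  ... | no ¬w = ⊥-elim (¬s λ x Px xh xy → ¬-not λ xz → ¬w (x , Px , xh , xy , xz))

-- Pencils and perspectivities

module _ {n m : ℕ} {R : Fin n → Fin m → Bool} {P : Fin n → Bool} where

  module _ {Q : Fin m → Bool} (pen : Pencils R P Q) where
    open Pencils pen

    -- When neither `y₁` nor `y₂` serves, take the member `z` of their pencil through `x₂`. It
    -- differs from both, so a point on `z` and on one of them is on the other too; hence `x₁` and
    -- `x₃` are off `z`.
    common-trans : ∀ {x₁ x₂ x₃ y₁ y₂} → P x₁ ≡ true → P x₂ ≡ true → P x₃ ≡ true →
      Q y₁ ≡ true → Q y₂ ≡ true →
      R x₁ y₁ ≡ true → R x₂ y₁ ≡ true → R x₂ y₂ ≡ true → R x₃ y₂ ≡ true →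
      ∃ λ z → Q z ≡ true × R x₁ z ≡ true × R x₃ z ≡ true
    common-trans {x₁} {x₂} {x₃} {y₁} {y₂} P₁ P₂ P₃ Q₁ Q₂ x₁y₁ x₂y₁ x₂y₂ x₃y₂
      with R x₁ y₂ in x₁y₂ | R x₃ y₁ in x₃y₁
    ... | true  | _     = y₂ , Q₂ , x₁y₂ , x₃y₂
    ... | false | true  = y₁ , Q₁ , x₁y₁ , x₃y₁
    ... | false | false with through P₂ Q₁ Q₂ (distinct R x₁y₁ x₁y₂)
    ...   | z , Qz , z∈ , x₂z = z , Qz , ¬-not ¬x₁z , ¬-not ¬x₃z
      where
      ¬x₁z : R x₁ z ≢ false
      ¬x₁z x₁z = true≢false x₁y₁
        (meet Q₁ Q₂ Q₂ Qz (distinct R x₂y₂ x₂z) (span-right R) z∈ x₁ P₁ x₁y₂ x₁z)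
      ¬x₃z : R x₃ z ≢ false
      ¬x₃z x₃z = true≢false x₃y₂
        (meet Q₂ Q₁ Q₁ Qz (distinct R x₂y₁ x₂z) (span-right R) (span-swap R z∈) x₃ P₃ x₃y₁ x₃z)

    -- The injection is h ↦ (h ∩ y) ∨ x₂.
    perspectivity : ∀ {x₁ x₂ y} → P x₁ ≡ true → P x₂ ≡ true → Q y ≡ true →
      R x₁ y ≡ true → R x₂ y ≡ true →
      count (λ h → Q h ∧ not (R x₁ h)) ≤ count (λ h → Q h ∧ not (R x₂ h))
    perspectivity {x₁} {x₂} {y} P₁ P₂ Qy x₁y x₂y = count-injection (λ h → Q h ∧ not (R x₁ h)) (λ h → Q h ∧ not (R x₂ h))
      (λ h on → proj₁ (image h on))
      (λ h on → let _ , Qz , _ , x₂z = image h on in ∧-intro Qz (cong not x₂z))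
      injective
      where
      image : ∀ h → Q h ∧ not (R x₁ h) ≡ true → ∃ λ z → Q z ≡ true × Span R P h y z × R x₂ z ≡ false
      image h on = through P₂ (∧-conicalˡ _ _ on) Qy
        (λ h≡y → distinct R x₁y (not-true (∧-conicalʳ _ _ on)) (≡-sym h≡y))

      back : ∀ {h z} → Q h ≡ true → Q z ≡ true → R x₂ z ≡ false → Span R P h y z → Span R P y z h
      back Qh Qz x₂z z∈ = meet Qh Qy Qy Qz (distinct R x₂y x₂z) (span-right R) z∈

      injective : ∀ h₁ h₂ on₁ on₂ → proj₁ (image h₁ on₁) ≡ proj₁ (image h₂ on₂) → h₁ ≡ h₂
      injective h₁ h₂ on₁ on₂ e with image h₁ on₁ | image h₂ on₂
      ... | z , Qz , z∈₁ , x₂z | _ , _ , z∈₂ , _ with refl ← e with h₁ ≟ h₂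
      ...   | yes h₁≡h₂ = h₁≡h₂
      -- Distinct `h₁` and `h₂` generate the pencil of `y` and `z`, so `y` would contain their
      -- common point `x₁`.
      ...   | no  h₁≢h₂ = ⊥-elim (true≢false x₁y
        (meet Qy Qz Q₁ Q₂ h₁≢h₂ (back Q₁ Qz x₂z z∈₁) (back Q₂ Qz x₂z z∈₂) x₁ P₁
          (not-true (∧-conicalʳ _ _ on₁)) (not-true (∧-conicalʳ _ _ on₂))))
        where
        Q₁ = ∧-conicalˡ _ _ on₁
        Q₂ = ∧-conicalˡ _ _ on₂

-- By `cocommon` some hyperplane avoids both points, and its perspectivities in the two directions
-- bound each count by the other.
pencil-size : ∀ {n m} {R : Fin n → Fin m → Bool} {P Q} → Geometry R P Q →
  ∀ {x₁ x₂} → P x₁ ≡ true → P x₂ ≡ true →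
  count (λ h → Q h ∧ not (R x₁ h)) ≡ count (λ h → Q h ∧ not (R x₂ h))
pencil-size g P₁ P₂ with Geometry.cocommon g P₁ P₂
... | y , Qy , x₁y , x₂y = ≤-antisym
  (perspectivity (Geometry.pencils g) P₁ P₂ Qy x₁y x₂y)
  (perspectivity (Geometry.pencils g) P₂ P₁ Qy x₂y x₁y)

-- For x off y, the points of y and the hyperplanes through x form a geometry of rank one less:
-- hyperplanes through x correspond to hyperplanes of y by intersection.
module _ {n m : ℕ} {R : Fin n → Fin m → Bool} {P : Fin n → Bool} {Q : Fin m → Bool}
  (g : Geometry R P Q) {x : Fin n} {y : Fin m}
  (Px : P x ≡ true) (Qy : Q y ≡ true) (xy : R x y ≡ true) where

  open Geometry g
  open Pencils pencils
  private
    module Co = Pencils copencils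

    P′ : Fin n → Bool
    P′ p = P p ∧ not (R p y)

    Q′ : Fin m → Bool
    Q′ h = Q h ∧ not (R x h)

    inQ : ∀ {h} → Q′ h ≡ true → Q h ≡ true
    inQ = ∧-conicalˡ _ _

    onx : ∀ {h} → Q′ h ≡ true → R x h ≡ false
    onx h = not-true (∧-conicalʳ _ _ h)

    span-restrict : ∀ {h w z} → Span R P h w z → Span R P′ h w z
    span-restrict s p P′p = s p (∧-conicalˡ _ _ P′p)

  -- The line joining a point `p` of `h` and `w` to `x` meets `y` in a point `q` of `P′`. By
  -- hypothesis `q` is on `z`, which contains `x` as well and therefore `p`.
  span-extend : ∀ {h w z} → Q′ h ≡ true → Q′ w ≡ true → Q′ z ≡ true → Span R P′ h w z → Span R P h w z
  span-extend {h} {w} {z} h′ w′ z′ s p Pp ph pw = ¬-not λ pz →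
    let q , Pq , q∈ , qy = Co.through Qy Pp Px (distinct (flip R) pz (onx z′))
        qz = s q (∧-intro Pq (cong not qy)) (q∈ h (inQ h′) ph (onx h′)) (q∈ w (inQ w′) pw (onx w′))
    in true≢false pz
         (Co.meet Pp Px Px Pq (distinct (flip R) xy qy) (span-right (flip R)) q∈ z (inQ z′) (onx z′) qz)

  restrict-pencils : Pencils R P′ Q′
  restrict-pencils = record
    { through = λ p′ h′ w′ h≢w →
        let z , Qz , z∈ , pz = through (∧-conicalˡ _ _ p′) (inQ h′) (inQ w′) h≢w
        in z , ∧-intro Qz (cong not (z∈ x Px (onx h′) (onx w′))) , span-restrict z∈ , pz
    ; meet = λ h′ w′ z₁′ z₂′ z₁≢z₂ s₁ s₂ → span-restrict
        (meet (inQ h′) (inQ w′) (inQ z₁′) (inQ z₂′) z₁≢z₂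
          (span-extend h′ w′ z₁′ s₁) (span-extend h′ w′ z₂′ s₂))
    ; antichain = λ z′ w′ s → antichain (inQ z′) (inQ w′) (span-extend z′ z′ w′ s)
    }

  -- Distinct `y₁` and `y₂` have a third member `y₃` in their pencil, through a point off both. It
  -- contains `x`, so `y` is outside the pencil of `y₁` and `y₃`, and some point of `y` and `y₃` is
  -- off `y₁`.
  restrict-common : ∀ {y₁ y₂} → Q′ y₁ ≡ true → Q′ y₂ ≡ true →
    ∃ λ p → P′ p ≡ true × R p y₁ ≡ true × R p y₂ ≡ true
  restrict-common {y₁} {y₂} y₁′ y₂′ with y₁ ≟ y₂
  ... | yes refl =
    let p , Pp , py , _ , py₁ = not-span R λ s → distinct R xy (onx y₁′) (antichain Qy (inQ y₁′) s)
    in p , ∧-intro Pp (cong not py) , py₁ , py₁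
  ... | no y₁≢y₂ with common (inQ y₁′) (inQ y₂′)
  ...   | p₀ , Pp₀ , p₀y₁ , p₀y₂ with through Pp₀ (inQ y₁′) (inQ y₂′) y₁≢y₂
  -- A point of y ∩ y₃ off y₁ is also off y₂, as y₁ belongs to the pencil of y₂ and y₃.
  ...     | y₃ , Qy₃ , y₃∈ , p₀y₃ =
    let p , Pp , py , py₃ , py₁ = not-span R λ s → true≢false xy
          (meet Qy Qy₃ (inQ y₁′) Qy₃ (distinct R p₀y₁ p₀y₃) s (span-right R) x Px (onx y₁′)
            (y₃∈ x Px (onx y₁′) (onx y₂′)))
    in p , ∧-intro Pp (cong not py) , py₁ , ¬-not λ py₂ → true≢false py₁
         (meet (inQ y₁′) (inQ y₂′) (inQ y₂′) Qy₃ (distinct R p₀y₂ p₀y₃) (span-right R) y₃∈ p Pp py₂ py₃)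

restrict : ∀ {n m} {R : Fin n → Fin m → Bool} {P Q} → Geometry R P Q →
  ∀ {x y} → P x ≡ true → Q y ≡ true → R x y ≡ true →
  Geometry R (λ p → P p ∧ not (R p y)) (λ h → Q h ∧ not (R x h))
restrict g Px Qy xy = record
  { pencils   = restrict-pencils g Px Qy xy
  ; copencils = restrict-pencils (dual g) Qy Px xy
  ; common    = restrict-common g Px Qy xy
  ; cocommon  = restrict-common (dual g) Qy Px xy
  }

-- As many points as hyperplanes

unique-hyperplane : ∀ {n m} {R : Fin n → Fin m → Bool} {P Q} → Geometry R P Q →
  ∀ {x} → P x ≡ true → count (λ h → Q h ∧ not (R x h)) ≡ 0 →
  ∀ h₁ h₂ → Q h₁ ≡ true → Q h₂ ≡ true → h₁ ≡ h₂
unique-hyperplane g {x} Px none h₁ h₂ Q₁ Q₂ with h₁ ≟ h₂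
... | yes h₁≡h₂ = h₁≡h₂
... | no  h₁≢h₂ with Pencils.through (Geometry.pencils g) Px Q₁ Q₂ h₁≢h₂
...   | z , Qz , _ , xz = ⊥-elim (<⇒≢ (count-pos _ z (∧-intro Qz (cong not xz))) (≡-sym none))

-- Double counting incidences gives c |P| = c |Q|, where c counts the hyperplanes through any
-- point as well as the points on any hyperplane.
balanced-upto : ∀ s {n m} {R : Fin n → Fin m → Bool} {P Q} → Geometry R P Q → count P ≤ s → count P ≡ count Q
balanced-upto s {P = P} {Q} g P≤s with any? (λ x → P x ≟ᵇ true)
... | no ¬P = trans (count-empty P (λ x Px → ¬P (x , Px))) (≡-sym (count-empty Q ¬Q))
  where
  ¬Q : ∀ y → Q y ≢ true
  ¬Q y Qy = let x , Px , _ = Geometry.common g Qy Qy in ¬P (x , Px)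
balanced-upto zero {P = P} g P≤0 | yes (x , Px) = ⊥-elim (≤⇒≯ P≤0 (count-pos P x Px))
balanced-upto (suc s) {R = R} {P} {Q} g P≤s | yes (x , Px) with Geometry.cocommon g Px Px
... | y , Qy , xy , _ = conclude (count (λ h → Q h ∧ not (R x h))) refl
  where
  points : ℕ
  points = count (λ p → P p ∧ not (R p y))

  -- Restricting drops the point `x`, which is off `y`; this drives the induction on `s`.
  smaller : points < count P
  smaller = begin-strict
    points                                    ≡⟨ +-identityʳ points ⟨
    points + 0                                <⟨ +-monoʳ-< points (count-pos _ x (∧-intro Px xy)) ⟩
    points + count (λ p → P p ∧ R p y)        ≡⟨ count-split P (λ p → R p y) ⟨
    count P                                   ∎
    where open ≤-Reasoning

  points≡ : points ≡ count (λ h → Q h ∧ not (R x h))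
  points≡ = balanced-upto s (restrict g Px Qy xy) (≤-pred (≤-trans smaller P≤s))

  conclude : ∀ c → count (λ h → Q h ∧ not (R x h)) ≡ c → count P ≡ count Q
  -- Here `c` cannot be cancelled, but the rank is one: there is a single point and a single
  -- hyperplane, so constant maps are injective.
  conclude zero none = ≤-antisym
    (count-injection P Q (λ _ _ → y) (λ _ _ → Qy)
      (λ x₁ x₂ P₁ P₂ _ → unique-hyperplane (dual g) Qy (trans points≡ none) x₁ x₂ P₁ P₂))
    (count-injection Q P (λ _ _ → x) (λ _ _ → Px)
      (λ y₁ y₂ Q₁ Q₂ _ → unique-hyperplane g Px none y₁ y₂ Q₁ Q₂))
  conclude (suc c) hyper = *-cancelʳ-≡ (count P) (count Q) (suc c)
    (double-count P Q (λ p h → not (R p h)) (suc c)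
      (λ p Pp → trans (pencil-size g Pp Px) hyper)
      (λ h Qh → trans (pencil-size (dual g) Qh Qy) (trans points≡ hyper)))

balanced : ∀ {n m} {R : Fin n → Fin m → Bool} {P Q} → Geometry R P Q → count P ≡ count Q
balanced g = balanced-upto _ g ≤-refl

-- Both the whole geometry and its restriction at `x` and `y` are balanced; the two sides are the
-- differences.
antiflag-degrees : ∀ {n m} {R : Fin n → Fin m → Bool} {P Q} → Geometry R P Q →
  ∀ {x y} → P x ≡ true → Q y ≡ true → R x y ≡ true →
  count (λ h → Q h ∧ R x h) ≡ count (λ p → P p ∧ R p y)
antiflag-degrees {R = R} {P} {Q} g {x} {y} Px Qy xy = +-cancelˡ-≡ points _ _ (begin
  points + count (λ h → Q h ∧ R x h)  ≡⟨ cong (_+ count (λ h → Q h ∧ R x h)) (balanced (restrict g Px Qy xy)) ⟩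
  count (λ h → Q h ∧ not (R x h)) + count (λ h → Q h ∧ R x h)  ≡⟨ count-split Q (R x) ⟨
  count Q                             ≡⟨ balanced g ⟨
  count P                             ≡⟨ count-split P (λ p → R p y) ⟩
  points + count (λ p → P p ∧ R p y)  ∎)
  where
  open ≡-Reasoning
  points : ℕ
  points = count (λ p → P p ∧ not (R p y))

-- Change of relation and passage to a component

everything : ∀ {n} → Fin n → Bool
everything _ = true

pencils-resp : ∀ {n m} {R S : Fin n → Fin m → Bool} {P Q} → (∀ x y → R x y ≡ S x y) → Pencils R P Q → Pencils S P Q
pencils-resp {R = R} {S} {P} R≗S pen = record
  { through = λ {x} Px Qh Qy h≢y →
      let z , Qz , z∈ , xz = through Px Qh Qy h≢y in z , Qz , to z∈ , trans (≡-sym (R≗S x z)) xz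
  ; meet = λ Qh Qy Q₁ Q₂ z₁≢z₂ s₁ s₂ → to (meet Qh Qy Q₁ Q₂ z₁≢z₂ (from s₁) (from s₂))
  ; antichain = λ Qz Qw s → antichain Qz Qw (from s)
  }
  where
  open Pencils pen
  to : ∀ {h y z} → Span R P h y z → Span S P h y z
  to {h} {y} {z} s x Px xh xy = trans (≡-sym (R≗S x z)) (s x Px (trans (R≗S x h) xh) (trans (R≗S x y) xy))
  from : ∀ {h y z} → Span S P h y z → Span R P h y z
  from {h} {y} {z} s x Px xh xy = trans (R≗S x z) (s x Px (trans (≡-sym (R≗S x h)) xh) (trans (≡-sym (R≗S x y)) xy))

-- Points outside `P` lie on every hyperplane of `Q`, so ignoring them leaves spans unchanged. A
-- pencil stays in `Q`: a point off one of its members is off one of the two generators.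
pencils-component : ∀ {n m} {R : Fin n → Fin m → Bool} {P Q} → Pencils R everything everything →
  (∀ {x y} → R x y ≡ true → P x ≡ true → Q y ≡ true) →
  (∀ {x y} → R x y ≡ true → Q y ≡ true → P x ≡ true) →
  (∀ y → ∃ λ x → R x y ≡ true) →
  Pencils R P Q
pencils-component {R = R} {P} {Q} pen P⇒Q Q⇒P nonempty = record
  { through = λ Px Qh Qy h≢y →
      let z , _ , z∈ , xz = through refl refl refl h≢y in z , in-component Qh Qy z∈ , (λ x _ → z∈ x refl) , xz
  ; meet = λ Qh Qy Q₁ Q₂ z₁≢z₂ s₁ s₂ x _ →
      meet refl refl refl refl z₁≢z₂ (extend Q₁ s₁) (extend Q₂ s₂) x refl
  ; antichain = λ Qz Qw s → antichain refl refl (extend Qw s)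
  }
  where
  open Pencils pen
  extend : ∀ {h y z} → Q z ≡ true → Span R P h y z → Span R everything h y z
  extend Qz s x _ xh xy = ¬-not λ xz → true≢false xz (s x (Q⇒P xz Qz) xh xy)

  in-component : ∀ {h y z} → Q h ≡ true → Q y ≡ true → Span R everything h y z → Q z ≡ true
  in-component {h} {y} {z} Qh Qy z∈ with nonempty z
  ... | a , az with R a h in ah | R a y in ay
  ...   | true  | _     = P⇒Q az (Q⇒P ah Qh)
  ...   | false | true  = P⇒Q az (Q⇒P ay Qy)
  ...   | false | false = ⊥-elim (true≢false az (z∈ a refl ah ay))

-- Legal sequences

∣⁅x⁆∪p∣≤1+∣p∣ : ∀ {n} (x : Fin n) (p : Subset n) → ∣ ⁅ x ⁆ ∪ p ∣ ≤ suc ∣ p ∣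
∣⁅x⁆∪p∣≤1+∣p∣ zero    (b ∷ p) rewrite ∪-identityˡ p = s≤s (∣p∣≤∣x∷p∣ b p)
∣⁅x⁆∪p∣≤1+∣p∣ (suc x) (true ∷ p)  = s≤s (∣⁅x⁆∪p∣≤1+∣p∣ x p)
∣⁅x⁆∪p∣≤1+∣p∣ (suc x) (false ∷ p) = ∣⁅x⁆∪p∣≤1+∣p∣ x p

module _ {n : ℕ} (G : Graph n) where

  Dominates : List (Fin n) → Fin n → Set
  Dominates L w = Any (λ u → adj G u w ≡ true) L

  Misses : List (Fin n) → Fin n → Set
  Misses L w = All (λ u → adj G u w ≡ false) L

  -- Legal sequences with the most recent vertex first.
  data Legal : List (Fin n) → Set where
    []  : Legal []
    add : ∀ {v L} w → adj G v w ≡ true → Misses L w → Legal L → Legal (v ∷ L)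

  dominates⊎misses : ∀ L w → Dominates L w ⊎ Misses L w
  dominates⊎misses [] w = inj₂ []
  dominates⊎misses (u ∷ L) w with adj G u w in uw | dominates⊎misses L w
  ... | true  | _      = inj₁ (here uw)
  ... | false | inj₁ d = inj₁ (there d)
  ... | false | inj₂ m = inj₂ (uw ∷ m)

  ¬dominates∧misses : ∀ {L w} → Dominates L w → ¬ Misses L w
  ¬dominates∧misses (here uw)  (uw′ ∷ _) = true≢false uw uw′
  ¬dominates∧misses (there d) (_ ∷ m)    = ¬dominates∧misses d m

  adj-comm : ∀ {u v b} → adj G u v ≡ b → adj G v u ≡ b
  adj-comm {u} {v} uv = trans (Graph.sym G v u) uv

  ∈N⁺ : ∀ {u v} → adj G u v ≡ true → v ∈ N G u
  ∈N⁺ {u} {v} uv = lookup⇒[]= v _ (trans (lookup∘tabulate (adj G u) v) uv)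

  ∈N⁻ : ∀ {u v} → v ∈ N G u → adj G u v ≡ true
  ∈N⁻ {u} {v} v∈ = trans (≡-sym (lookup∘tabulate (adj G u) v)) ([]=⇒lookup v∈)

  legalFrom-snoc : ∀ pre vs {v} w → adj G v w ≡ true → Misses (pre ++ vs) w →
    LegalFrom G pre vs → LegalFrom G pre (vs ++ [ v ])
  legalFrom-snoc []        []        w vw m l = tt
  legalFrom-snoc (p ∷ pre) []        w vw m l = (w , ∈N⁺ vw , subst (λ L → Misses L w) (++-identityʳ (p ∷ pre)) m) , tt
  legalFrom-snoc []        (u ∷ vs)  w vw m l = legalFrom-snoc [ u ] vs w vw m l
  legalFrom-snoc (p ∷ pre) (u ∷ vs)  w vw m (new , l) =
    new , legalFrom-snoc (p ∷ pre ++ [ u ]) vs w vw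
            (subst (λ L → Misses L w) (≡-sym (++-assoc (p ∷ pre) [ u ] vs)) m) l

  misses-reverse : ∀ {L w} → Misses L w → Misses (reverse L) w
  misses-reverse {L} = All-resp-↭ (↭-sym (↭-reverse L))

  legal⇒legalFrom : ∀ {L} → Legal L → LegalFrom G [] (reverse L)
  legal⇒legalFrom [] = tt
  legal⇒legalFrom (add {v} {L} w vw m l) rewrite unfold-reverse v L =
    legalFrom-snoc [] (reverse L) w vw (misses-reverse m) (legal⇒legalFrom l)

  -- The witness `w` is adjacent to `v` but to no earlier vertex.
  legal⇒unique : ∀ {L} → Legal L → Unique (reverse L)
  legal⇒unique [] = []
  legal⇒unique (add {v} {L} w vw m l) rewrite unfold-reverse v L =
    AllPairs.++⁺ (legal⇒unique l) ([] ∷ [])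
      (All.map (λ uw → (λ { refl → true≢false vw uw }) ∷ []) (misses-reverse m))

  fromList : List (Fin n) → Subset n
  fromList []      = ∅
  fromList (v ∷ L) = ⁅ v ⁆ ∪ fromList L

  ∈-fromList : ∀ {v L} → v ∈ₗ L → v ∈ fromList L
  ∈-fromList {v} (here refl) = x∈p∪q⁺ (inj₁ (x∈⁅x⁆ v))
  ∈-fromList (there v∈)      = x∈p∪q⁺ (inj₂ (∈-fromList v∈))

  ∣fromList∣≤length : ∀ L → ∣ fromList L ∣ ≤ length L
  ∣fromList∣≤length []      = ≤-reflexive (∣⊥∣≡0 n)
  ∣fromList∣≤length (v ∷ L) = ≤-trans (∣⁅x⁆∪p∣≤1+∣p∣ v (fromList L)) (s≤s (∣fromList∣≤length L))

  -- Geometry from uniformity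

  module Uniform (twinFree : FalseTwinFree G) {k : ℕ} (uniform : TotalUniform G k) where

    neighbour : ∀ v → ∃ λ u → adj G v u ≡ true
    neighbour v = let (_ , tds , _) , _ = proj₁ uniform ; u , _ , u∈N = tds v in u , ∈N⁻ u∈N

    k≤length : ∀ {L} → (∀ w → Dominates L w) → k ≤ length L
    k≤length {L} dom = ≤-trans (proj₂ (proj₁ uniform) (fromList L) tds) (∣fromList∣≤length L)
      where
      tds : TotalDominatingSet G (fromList L)
      tds w = let u , u∈L , uw = find (dom w) in u , ∈-fromList u∈L , ∈N⁺ (adj-comm uw)

    length≤k : ∀ {L} → Legal L → (∀ w → Dominates L w) → length L ≤ k
    length≤k {L} l dom = subst (_≤ k) (length-reverse L)
      (proj₂ (proj₂ uniform) (reverse L)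
        ((legal⇒unique l , legal⇒legalFrom l) ,
         λ w → let u , u∈L , uw = find (reverse⁺ (dom w)) in u , u∈L , ∈N⁺ (adj-comm uw)))

    -- Greedy completion: an undominated vertex `w` is itself the witness that makes adding any of
    -- its neighbours legal.
    cover : ∀ {L} → Legal L → ∀ ws → ∃ λ M → Legal (M ++ L) × All (Dominates (M ++ L)) ws
    cover l [] = [] , l , []
    cover {L} l (w ∷ ws) with cover l ws
    ... | M , lM , dom with dominates⊎misses (M ++ L) w
    ...   | inj₁ d = M , lM , d ∷ dom
    ...   | inj₂ m = let v , wv = neighbour w in
      v ∷ M , add w (adj-comm wv) m lM , here (adj-comm wv) ∷ All.map there dom

    -- Both sequences are completed by the same vertices.
    legal-shortest : ∀ {L L′} → Legal L → (∀ {w} → Dominates L w → Dominates L′ w) → length L ≤ length L′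
    legal-shortest {L} {L′} l L⊆L′ with cover l (allFin n)
    ... | M , lM , dom = +-cancelˡ-≤ (length M) _ _ (begin
      length M + length L   ≡⟨ length-++ M ⟨
      length (M ++ L)       ≤⟨ length≤k lM (λ w → All.lookup dom (∈-allFin w)) ⟩
      k                     ≤⟨ k≤length {M ++ L′} (λ w → replace (All.lookup dom (∈-allFin w))) ⟩
      length (M ++ L′)      ≡⟨ length-++ M ⟩
      length M + length L′  ∎)
      where
      open ≤-Reasoning
      replace : ∀ {w} → Dominates (M ++ L) w → Dominates (M ++ L′) w
      replace d with ++⁻ M d
      ... | inj₁ dM = ++⁺ˡ dM
      ... | inj₂ dL = ++⁺ʳ M (L⊆L′ dL)

    legal-length : ∀ {L} → Legal L → length L ≤ k
    legal-length {L} l with cover l (allFin n)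
    ... | M , lM , dom = ≤-trans (≤-trans (m≤n+m (length L) (length M)) (≤-reflexive (≡-sym (length-++ M))))
      (length≤k lM (λ w → All.lookup dom (∈-allFin w)))

    -- The pencils live in the relation flip adj: x lies on y when y does not dominate x.
    Spans : Fin n → Fin n → Fin n → Set
    Spans = Span (flip (adj G)) everything

    -- If `N(z)` were properly inside `N(w)`, then `z`, `w` would be legal yet dominate no more than
    -- `w` alone, against `legal-shortest`. Equality is excluded by twin-freeness.
    separate : ∀ {z w} → z ≢ w → ∃ λ a → adj G z a ≡ true × adj G w a ≡ false
    separate {z} {w} z≢w with any? (λ a → adj G z a ≟ᵇ true ×-dec adj G w a ≟ᵇ false)
    ... | yes found = found
    ... | no none with any? (λ a → adj G w a ≟ᵇ true ×-dec adj G z a ≟ᵇ false)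
    ...   | no none′ = ⊥-elim (twinFree z w (z≢w , tabulate-cong agree))
      where
      agree : ∀ a → adj G z a ≡ adj G w a
      agree a with adj G z a in za | adj G w a in wa
      ... | true  | true  = refl
      ... | false | false = refl
      ... | true  | false = ⊥-elim (none (a , za , wa))
      ... | false | true  = ⊥-elim (none′ (a , wa , za))
    ...   | yes (a , wa , za) = ⊥-elim (1+n≰n (legal-shortest {L′ = [ w ]} legal dominated))
      where
      legal : Legal (w ∷ z ∷ [])
      legal = let b , zb = neighbour z in add a wa (za ∷ []) (add b zb [] [])
      dominated : ∀ {x} → Dominates (w ∷ z ∷ []) x → Dominates [ w ] x
      dominated (here wx) = here wx
      dominated {x} (there (here zx)) = here (¬-not λ wx → none (x , zx , wx))

    -- A neighbour `x` of `h` missed by `z₁` and `z₂` would make `z₁`, `z₂`, `h` legal, although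
    -- these three dominate no more than `h` and `y`.
    meet-graph : ∀ {h y z₁ z₂} → z₁ ≢ z₂ → Spans h y z₁ → Spans h y z₂ → Spans z₁ z₂ h
    meet-graph {h} {y} {z₁} {z₂} z₁≢z₂ s₁ s₂ x _ z₁x z₂x = ¬-not λ hx →
      let b , z₁b = neighbour z₁
          a , z₂a , z₁a = separate (λ e → z₁≢z₂ (≡-sym e))
      in 1+n≰n (legal-shortest {L′ = h ∷ y ∷ []}
           (add x hx (z₂x ∷ z₁x ∷ []) (add a z₂a (z₁a ∷ []) (add b z₁b [] [])))
           dominated)
      where
      dominated : ∀ {x} → Dominates (h ∷ z₂ ∷ z₁ ∷ []) x → Dominates (h ∷ y ∷ []) x
      dominated {x} d with dominates⊎misses (h ∷ y ∷ []) x
      ... | inj₁ d′ = d′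
      ... | inj₂ (hx ∷ yx ∷ []) = ⊥-elim (¬dominates∧misses d (hx ∷ s₂ x refl hx yx ∷ s₁ x refl hx yx ∷ []))

    -- A vertex of `F` is added exactly when it has a neighbour not yet dominated, which gives a
    -- maximal legal sequence inside `F`.
    basis : ∀ {F : Fin n → Set} → (∀ f → Dec (F f)) → ∀ fs →
      ∃ λ B → Legal B × All F B × All (λ f → F f → ∀ w → adj G f w ≡ true → Dominates B w) fs
    basis F? [] = [] , [] , [] , []
    basis F? (f ∷ fs) with basis F? fs
    ... | B , lB , FB , spans with F? f
    ...   | no ¬Ff = B , lB , FB , (λ Ff → ⊥-elim (¬Ff Ff)) ∷ spans
    ...   | yes Ff with any? (λ w → adj G f w ≟ᵇ true ×-dec All.all? (λ u → adj G u w ≟ᵇ false) B)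
    ...     | yes (w , fw , m) = f ∷ B , add w fw m lB , Ff ∷ FB ,
      (λ _ _ fw → here fw) ∷ All.map (λ s Fg w gw → there (s Fg w gw)) spans
    ...     | no none = B , lB , FB , (λ _ → dominated) ∷ spans
      where
      dominated : ∀ w → adj G f w ≡ true → Dominates B w
      dominated w fw with dominates⊎misses B w
      ... | inj₁ d = d
      ... | inj₂ m = ⊥-elim (none (w , fw , m))

    -- A legal sequence B exhausting the neighbourhoods of h ∩ y leaves h and y undominated, so it
    -- extends by two vertices; hence B together with x cannot dominate, and z is what it misses.
    through-graph : ∀ x {h y} → h ≢ y → ∃ λ z → Spans h y z × adj G z x ≡ false
    through-graph x {h} {y} h≢y
      with basis (λ f → adj G h f ≟ᵇ false ×-dec adj G y f ≟ᵇ false) (allFin n)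
    ... | B , lB , FB , spans with any? (λ z → All.all? (λ u → adj G u z ≟ᵇ false) (x ∷ B))
    ...   | yes (z , xz ∷ m) = z , z∈ , adj-comm xz
      where
      z∈ : Spans h y z
      z∈ p _ hp yp = ¬-not λ zp → ¬dominates∧misses (All.lookup spans (∈-allFin p) (hp , yp) z (adj-comm zp)) m
    ...   | no none = ⊥-elim (1+n≰n (≤-trans (legal-length longer) (k≤length {x ∷ B} dom)))
      where
      dom : ∀ w → Dominates (x ∷ B) w
      dom w with dominates⊎misses (x ∷ B) w
      ... | inj₁ d = d
      ... | inj₂ m = ⊥-elim (none (w , m))
      -- `a` dominates `h` but not `y`, which leaves `y` as the witness for `b`.
      a = proj₁ (separate h≢y)
      b = proj₁ (neighbour y)
      longer : Legal (b ∷ a ∷ B)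
      longer = let _ , ha , ya = separate h≢y ; _ , yb = neighbour y in
        add y (adj-comm yb) (adj-comm ya ∷ All.map (λ F → adj-comm (proj₂ F)) FB)
          (add h (adj-comm ha) (All.map (λ F → adj-comm (proj₁ F)) FB) lB)

    dominated-pencils : Pencils (flip (adj G)) everything everything
    dominated-pencils = record
      { through = λ {x} _ _ _ h≢y → let z , z∈ , zx = through-graph x h≢y in z , refl , z∈ , zx
      ; meet = λ _ _ _ _ → meet-graph
      ; antichain = antichain-graph
      }
      where
      antichain-graph : ∀ {z w} → true ≡ true → true ≡ true → Spans z z w → z ≡ w
      antichain-graph {z} {w} _ _ s with z ≟ w
      ... | yes z≡w = z≡w
      ... | no  z≢w = let a , wa , za = separate (λ e → z≢w (≡-sym e)) in
        ⊥-elim (true≢false wa (s a refl za za))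

    adj-pencils : Pencils (adj G) everything everything
    adj-pencils = pencils-resp (λ x y → Graph.sym G y x) dominated-pencils

    -- Sides of an edge and degrees

    Linked : Fin n → Fin n → Set
    Linked u v = ∃ λ w → adj G u w ≡ true × adj G v w ≡ true

    linked? : ∀ u v → Dec (Linked u v)
    linked? u v = any? (λ w → adj G u w ≟ᵇ true ×-dec adj G v w ≟ᵇ true)

    linked-sym : ∀ {u v} → Linked u v → Linked v u
    linked-sym (w , uw , vw) = w , vw , uw

    -- A common neighbour is a hyperplane off both vertices, so `common-trans` applies.
    linked-trans : ∀ {u v w} → Linked u v → Linked v w → Linked u w
    linked-trans (a , ua , va) (b , vb , wb) =
      let c , _ , uc , wc = common-trans adj-pencils refl refl refl refl refl ua va vb wb in c , uc , wc

    side : Fin n → Fin n → Bool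
    side u x = does (linked? u x)

    side⁺ : ∀ {u x} → Linked u x → side u x ≡ true
    side⁺ {u} {x} = dec-true (linked? u x)

    side⁻ : ∀ {u x} → side u x ≡ true → Linked u x
    side⁻ {u} {x} = does⇒ (linked? u x)

    -- A common neighbour `w` of `u` and `x` is linked to `v` through `u` and to `y` through `x`.
    side-step : ∀ {u v x y} → adj G u v ≡ true → adj G x y ≡ true → side u x ≡ true → side v y ≡ true
    side-step {u} {v} {x} {y} uv xy ux with side⁻ ux
    ... | w , uw , xw = side⁺ (linked-trans (u , adj-comm uv , adj-comm uw) (x , adj-comm xw , adj-comm xy))

    side-common : ∀ {u v x₁ x₂} → adj G u v ≡ true → side u x₁ ≡ true → side u x₂ ≡ true →
      ∃ λ y → side v y ≡ true × adj G x₁ y ≡ true × adj G x₂ y ≡ true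
    side-common uv ux₁ ux₂ =
      let y , x₁y , x₂y = linked-trans (linked-sym (side⁻ ux₁)) (side⁻ ux₂)
      in y , side-step uv x₁y ux₁ , x₁y , x₂y

    -- If G is connected, the sides are its colour classes when G is bipartite, and all of G otherwise.
    component-geometry : ∀ {u v} → adj G u v ≡ true → Geometry (adj G) (side u) (side v)
    component-geometry {u} {v} uv = record
      { pencils = pencils-component adj-pencils
          (side-step uv)
          (λ xy → side-step vu (adj-comm xy))
          (λ y → let x , yx = neighbour y in x , adj-comm yx)
      ; copencils = pencils-component dominated-pencils
          (λ yx → side-step vu (adj-comm yx))
          (side-step uv)
          neighbour
      ; common = λ vy₁ vy₂ →
          let x , ux , y₁x , y₂x = side-common vu vy₁ vy₂ in x , ux , adj-comm y₁x , adj-comm y₂x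
      ; cocommon = side-common uv
      }
      where
      vu : adj G v u ≡ true
      vu = adj-comm uv

    -- Each neighbour of `u` shares the neighbour `u` with `v`, so it already lies in `side v`.
    degree-side : ∀ {u v} → adj G u v ≡ true → count (λ h → side v h ∧ adj G u h) ≡ degree G u
    degree-side {u} {v} uv = trans (count-cong absorb) (≡-sym (∣tabulate∣≡count (adj G u)))
      where
      absorb : ∀ h → side v h ∧ adj G u h ≡ adj G u h
      absorb h with adj G u h in uh
      ... | true  = ∧-intro (side⁺ (u , adj-comm uv , adj-comm uh)) refl
      ... | false = ∧-zeroʳ (side v h)

    degree-adjacent : ∀ {u v} → adj G u v ≡ true → degree G u ≡ degree G v
    degree-adjacent {u} {v} uv = begin
      degree G u                            ≡⟨ degree-side uv ⟨
      count (λ h → side v h ∧ adj G u h)    ≡⟨ antiflag-degrees (component-geometry uv) (self u) (self v) uv ⟩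
      count (λ p → side u p ∧ adj G p v)    ≡⟨ count-cong (λ p → cong (side u p ∧_) (Graph.sym G p v)) ⟩
      count (λ p → side u p ∧ adj G v p)    ≡⟨ degree-side (adj-comm uv) ⟩
      degree G v                            ∎
      where
      open ≡-Reasoning
      self : ∀ w → side w w ≡ true
      self w = let a , wa = neighbour w in side⁺ (a , wa , wa)

    degree-walk : ∀ {u v} → Walk G u v → degree G u ≡ degree G v
    degree-walk here          = refl
    degree-walk (step uv vw)  = trans (degree-adjacent uv) (degree-walk vw)

theorem4p2 : (k : ℕ) → (∃ λ m → k ≡ 2 * suc m) → {n : ℕ} → (G : Graph n) →
    Connected G → FalseTwinFree G → TotalUniform G k → Regular G
-- The empty graph is regular of any degree; 0 is a default.
theorem4p2 k _ {zero}  G connected twinFree uniform = 0 , λ ()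
theorem4p2 k _ {suc n} G connected twinFree uniform =
  degree G zero , λ v → Uniform.degree-walk G twinFree uniform (connected v zero)
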